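{- For every function $f:\mathbb{N}\to\mathbb{N}$, every finite graph $G$ of local treewidth at most $f$, and every positive integer $r$, the hypergraph of balls of radius at most $r$ in $G$ has a proper array sample compression scheme of size $4f(2r)+8$.
   Context: $G$ has local treewidth at most $f$ if for every positive integer $r$ and every $v\in V(G)$, the induced subgraph $G[B_G(v,r)]$ has treewidth at most $f(r)$, where $B_G(v,s)=\{w:\mathrm{dist}_G(v,w)\le s\}$. The hypergraph of balls of radius at most $r$ in $G$ has vertex set $V(G)$ and hyperedges $B_G(c,s)$ for $c\in V(G)$ and integers $s\le r$. For a hypergraph $H$ (finite $V(H)$, $E(H)\subseteq 2^{V(H)}$): a sample is a pair $(X^+,X^-)$ of subsets of $V(H)$ such that some hyperedge $e$ has $X^+\subseteq e$, $X^-\cap e=\emptyset$; $\mathcal{S}(H)$ is the set of samples; $S$ realizes $(X^+,X^-)$ if $X^+\subseteq S$, $S\cap X^-=\emptyset$. With a fresh symbol $\bot\notin V(H)$, an array sample compression scheme of size $k$ is a pair $(\kappa,\rho)$, $\kappa:\mathcal{S}(H)\to(V(H)\cup\{\bot\})^k$, $\rho:(V(H)\cup\{\bot\})^k\to 2^{V(H)}$, such that for every sample, $\kappa(X^+,X^-)\in(X^+\cup X^-\cup\{\bot\})^k$ and $\rho(\kappa(X^+,X^-))$ realizes it; it is proper if all values of $\rho$ are hyperedges. -}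

module Defs where

open import Data.Bool using (true; false)
open import Data.Fin using (Fin; zero; suc; _≟_)
open import Data.Fin.Properties using (any?)
open import Data.Fin.Subset using (Subset; ∣_∣; _∈_; _⊆_; _∪_; _∩_; Empty)
open import Data.Integer as ℤ using (ℤ; +_; -[1+_])
open import Data.List using (List; []; _∷_)
open import Data.List.Relation.Unary.Unique.Propositional using (Unique)
open import Data.Maybe using (Maybe)
open import Data.Maybe.Relation.Unary.All using () renaming (All to MaybeAll)
open import Data.Nat using (ℕ; zero; suc; _≤_; _<_; s≤s)
open import Data.Nat.Properties using (anyUpTo?; allUpTo?)
open import Data.Product using (∃; ∃-syntax; _×_; _,_)
open import Data.Vec using (Vec; lookup; tabulate; []; _∷_)
open import Data.Vec.Relation.Unary.All using () renaming (All to VecAll)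
open import Level using (0ℓ)
open import Relation.Binary.Core using (Rel)
open import Relation.Binary.Definitions using (Decidable; Symmetric)
open import Relation.Binary.PropositionalEquality using (_≡_; refl)
open import Relation.Nullary using (¬_; Dec; does; no; ¬?; _×-dec_)
open import Relation.Nullary.Decidable using (map′)
open import Relation.Unary using (Pred)

-- A finite simple graph with vertex set Fin n; as befits a finite object,
-- adjacency is decidable.
record Graph (n : ℕ) : Set₁ where
  field
    Adj    : Rel (Fin n) 0ℓ
    adj?   : Decidable Adj
    sym    : Symmetric Adj
    irrefl : ∀ {v} → ¬ Adj v v

module _ {n : ℕ} (G : Graph n) where
  open Graph G

  data Walk : Fin n → Fin n → ℕ → Set where
    []  : ∀ {v} → Walk v v 0
    _∷_ : ∀ {u v w ℓ} → Adj u v → Walk v w ℓ → Walk u w (suc ℓ)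

  vertices : ∀ {u v ℓ} → Walk u v ℓ → List (Fin n)
  vertices {u} []      = u ∷ []
  vertices {u} (_ ∷ p) = u ∷ vertices p

  -- dist(u,w) = d.  The relation is partial: no d is related to u and w in
  -- different components, where the distance is infinite.
  Dist : Fin n → Fin n → ℕ → Set
  Dist u w d = Walk u w d × (∀ {ℓ} → ℓ < d → ¬ Walk u w ℓ)

  Dist≤ : Fin n → Fin n → ℤ → Set
  Dist≤ u w s = ∃[ d ] Dist u w d × + d ℤ.≤ s

  walk? : ∀ u w ℓ → Dec (Walk u w ℓ)
  walk? u w zero    = map′ (λ { refl → [] }) (λ { [] → refl }) (u ≟ w)
  walk? u w (suc ℓ) =
    map′ (λ { (v , e , p) → e ∷ p }) (λ { (e ∷ p) → _ , e , p })
         (any? λ v → adj? u v ×-dec walk? v w ℓ)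

  dist? : ∀ u w d → Dec (Dist u w d)
  dist? u w d = walk? u w d ×-dec allUpTo? (λ ℓ → ¬? (walk? u w ℓ)) d

  dist≤? : ∀ u w s → Dec (Dist≤ u w s)
  dist≤? u w (+ m) =
    map′ (λ { (d , s≤s d≤m , p) → d , p , ℤ.+≤+ d≤m })
         (λ { (d , p , ℤ.+≤+ d≤m) → d , s≤s d≤m , p })
         (anyUpTo? (dist? u w) (suc m))
  dist≤? u w -[1+ m ] = no λ { (_ , _ , ()) }

  -- The radius is an arbitrary integer; a ball of negative radius is empty.
  ball : Fin n → ℤ → Subset n
  ball v s = tabulate λ w → does (dist≤? v w s)

  Connected : Set
  Connected = ∀ u v → ∃[ ℓ ] Walk u v ℓ

  -- A cycle with ℓ + 1 ≥ 3 vertices: a path of length ℓ ≥ 2 closed by an edge.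
  Cycle : Set
  Cycle = ∃[ u ] ∃[ v ] ∃[ ℓ ] 2 ≤ ℓ ×
          (∃ λ (p : Walk u v ℓ) → Unique (vertices p)) × Adj v u

  IsTree : Set
  IsTree = 0 < n × Connected × ¬ Cycle

-- The increasing enumeration of the elements of a subset.
element : ∀ {n} (S : Subset n) → Fin ∣ S ∣ → Fin n
element (true  ∷ S) zero    = zero
element (true  ∷ S) (suc i) = suc (element S i)
element (false ∷ S) i       = suc (element S i)

-- Vertex i of the induced subgraph stands for the i-th element of S.
_[_] : ∀ {n} → Graph n → (S : Subset n) → Graph ∣ S ∣
G [ S ] = record
  { Adj    = λ i j → Adj (element S i) (element S j)
  ; adj?   = λ i j → adj? (element S i) (element S j)
  ; sym    = sym
  ; irrefl = irrefl
  }
  where open Graph G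

record TreeDecomposition {n : ℕ} (G : Graph n) : Set₁ where
  field
    {size} : ℕ
    tree   : Graph size
    isTree : IsTree tree
    bag    : Fin size → Subset n

  nodesOf : Fin n → Subset size
  nodesOf v = tabulate λ t → lookup (bag t) v

  field
    vertexCovered  : ∀ v → ∃[ t ] v ∈ bag t
    edgeCovered    : ∀ {u v} → Graph.Adj G u v → ∃[ t ] u ∈ bag t × v ∈ bag t
    nodesConnected : ∀ v → Connected (tree [ nodesOf v ])

-- The width is the maximum size of a bag minus one.
Width≤ : ∀ {n} {G : Graph n} → TreeDecomposition G → ℕ → Set
Width≤ D k = ∀ t → ∣ bag t ∣ ≤ suc k
  where open TreeDecomposition D

Treewidth≤ : ∀ {n} → Graph n → ℕ → Set₁
Treewidth≤ G k = ∃ λ (D : TreeDecomposition G) → Width≤ D k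

LocalTreewidth≤ : ∀ {n} → Graph n → (ℕ → ℕ) → Set₁
LocalTreewidth≤ G f = ∀ r → 0 < r → ∀ v → Treewidth≤ (G [ ball G v (+ r) ]) (f r)

-- A hypergraph on Fin n, given by its set of hyperedges.
Hypergraph : ℕ → Set₁
Hypergraph n = Pred (Subset n) 0ℓ

ballHypergraph : ∀ {n} → Graph n → ℕ → Hypergraph n
ballHypergraph G r e = ∃[ c ] ∃[ s ] s ℤ.≤ + r × e ≡ ball G c s

-- The field consistent is irrelevant, so that a function on samples depends
-- only on the pair (X⁺ , X⁻) and not on a hyperedge witnessing consistency.
record Sample {n : ℕ} (H : Hypergraph n) : Set where
  field
    X⁺ X⁻       : Subset n
    .consistent : ∃[ e ] H e × X⁺ ⊆ e × Empty (X⁻ ∩ e)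

Realizes : ∀ {n} {H : Hypergraph n} → Subset n → Sample H → Set
Realizes S x = X⁺ ⊆ S × Empty (S ∩ X⁻)
  where open Sample x

-- Arrays over V(H) ∪ {⊥}, with nothing in the role of ⊥.
Array : ℕ → ℕ → Set
Array n k = Vec (Maybe (Fin n)) k

record ArrayScheme {n : ℕ} (H : Hypergraph n) (k : ℕ) : Set where
  field
    κ        : Sample H → Array n k
    ρ        : Array n k → Subset n
    κ-sound  : ∀ x → VecAll (MaybeAll (_∈ (Sample.X⁺ x ∪ Sample.X⁻ x))) (κ x)
    realizes : ∀ x → Realizes (ρ (κ x)) x

Proper : ∀ {n k} {H : Hypergraph n} → ArrayScheme H k → Set
Proper {H = H} C = ∀ a → H (ArrayScheme.ρ C a)

module Submission where

-- Fix v ∈ X⁺.  Every ball of radius at most r that contains v lies in B = B(v, 2r), as do the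
-- shortest walks from its centre to its vertices.  A tree decomposition of G[B] is refined to a
-- binary tree with the vertices as leaves, in which the leaves below any node are separated from
-- the rest by t + 1 vertices.  The leaf of a centre c hangs off (or ends) a path of the subtree
-- spanned by X between two consecutive branchings; the two ends α ⊇ β of this path are determined
-- by three vertices of X, and their separators Z together cut c off from all of X.  Hence x ∈ X
-- is in B(c, s) iff d(c, z) + d(z, x) ≤ s for some z ∈ Z.  For each of the 2(t + 1) vertices z it
-- suffices to store the x ∈ X⁺ farthest from z that satisfies this inequality and the x ∈ X⁻
-- nearest to z: any ball centred in the same region with the same status for the stored pairs
-- realizes the sample.  Together with v this makes 4 + 4(t + 1) vertices.

open import Defs
open import Data.Bool using (true; false)
open import Data.Empty using (⊥-elim)
open import Data.Fin using (Fin; zero; suc; _≟_; fromℕ<; _↑ˡ_; _↑ʳ_)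
open import Data.Fin.Properties using (any?; all?)
open import Data.Fin.Subset using (Subset; Empty; Nonempty; _∈_; _∉_; _⊆_; _⊂_; _⊃_; _∪_; _∩_; _─_; _-_; ⁅_⁆; ⊤)
open import Data.Fin.Subset.Induction using (Acc; acc; ⊂-wellFounded; ⊃-wellFounded)
open import Data.Fin.Subset.Properties
  using (_∈?_; x∈⁅x⁆; x∈⁅y⁆⇒x≡y; x∈p∧x∉q⇒x∈p─q; p─q⊆p; x∈p∧x≢y⇒x∈p-y; ∈⊤
        ; p⊆p∪q; q⊆p∪q; x∈p∪q⁻; x∈p∩q⁺; x∈p∩q⁻; nonempty?)
import Data.Integer as ℤ
open import Data.List as List using (List; []; _∷_)
open import Data.List.Membership.Propositional using () renaming (_∈_ to _∈ₗ_)
open import Data.List.Membership.Propositional.Properties using (∈-filter⁺; ∈-filter⁻; ∈-allFin)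
open import Data.List.Relation.Unary.All as All using (All; []; _∷_)
open import Data.List.Relation.Unary.All.Properties using (All¬⇒¬Any; ¬Any⇒All¬)
open import Data.List.Relation.Unary.AllPairs using ([]; _∷_)
open import Data.List.Relation.Unary.Any using (here; there)
open import Data.List.Relation.Unary.Unique.Propositional using (Unique)
open import Data.List.Relation.Unary.Unique.Propositional.Properties using (allFin⁺; filter⁺)
open import Data.Maybe using (Maybe; just; nothing)
open import Data.Maybe.Relation.Unary.All as MaybeAll using (just; nothing) renaming (All to MaybeAll)
open import Data.Maybe.Relation.Unary.Any using (just) renaming (Any to MaybeAny)
open import Data.Nat using (ℕ; zero; suc; _+_; _*_; _≤_; _<_; z≤n; s≤s; _≤?_)
open import Data.Nat.Properties
  using (≤-trans; ≤-reflexive; <⇒≱; +-comm; +-assoc; +-identityʳ; +-mono-≤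
        ; m≤m+n; m≤n+m; +-monoʳ-≤; ≤-total; anyUpTo?)
open import Data.Nat.Solver using (module +-*-Solver)
open import Data.Product using (∃; ∃₂; ∃-syntax; _×_; _,_; proj₁; proj₂)
open import Data.Sum using (_⊎_; inj₁; inj₂; [_,_]′; swap)
open import Data.Vec as Vec using (tabulate; lookup; replicate; []; _∷_; here; there)
open import Data.Vec.Functional using (_++_)
open import Data.Vec.Functional.Properties using (lookup-++ˡ; lookup-++ʳ)
open import Data.Vec.Properties as Vec using (lookup-replicate; lookup∘tabulate; lookup⇒[]=; []=⇒lookup)
open import Data.Vec.Relation.Unary.All using ([]; _∷_) renaming (All to VecAll)
import Data.Vec.Relation.Unary.All.Properties as VecAll
open import Function using (_∘_; id; case_of_)
open import Level using (0ℓ)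
open import Relation.Binary.Core using (Rel)
open import Relation.Binary.Definitions using (Total; Transitive)
open import Relation.Binary.PropositionalEquality using (_≡_; _≢_; refl; sym; trans; cong; subst)
open import Relation.Nullary using (¬_; Dec; yes; no; does; ¬?; _×-dec_; _⊎-dec_; _→-dec_; contradiction)
open import Relation.Nullary.Decidable using (decidable-stable; dec-true; map′; recompute)
open import Relation.Unary using (Pred; Decidable)
open +-*-Solver using (solve; con; _:+_; _:*_; _:=_)

-- Membership in subsets of `Fin n`.

module _ {n} {P : Pred (Fin n) 0ℓ} (P? : Decidable P) where

  ∈-tabulate⁺ : ∀ {x} → P x → x ∈ tabulate (does ∘ P?)
  ∈-tabulate⁺ {x} px =
    lookup⇒[]= x _ (trans (lookup∘tabulate _ x) (dec-true (P? x) px))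

  ∈-tabulate⁻ : ∀ {x} → x ∈ tabulate (does ∘ P?) → P x
  ∈-tabulate⁻ {x} x∈ with P? x | trans (sym (lookup∘tabulate (does ∘ P?) x)) ([]=⇒lookup x∈)
  ... | yes px | _ = px
  ... | no  _  | ()

element-∈ : ∀ {n} (S : Subset n) i → element S i ∈ S
element-∈ (true  ∷ S) zero    = here
element-∈ (true  ∷ S) (suc i) = there (element-∈ S i)
element-∈ (false ∷ S) i       = there (element-∈ S i)

element-surjective : ∀ {n} {S : Subset n} {x} → x ∈ S → ∃ λ i → element S i ≡ x
element-surjective here = zero , refl
element-surjective {S = true  ∷ _} (there x∈S) with element-surjective x∈S
... | i , refl = suc i , refl
element-surjective {S = false ∷ _} (there x∈S) with element-surjective x∈S
... | i , refl = i , refl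

x∈p-y⇒x≢y : ∀ {n} {S : Subset n} {x y} → x ∈ S - y → x ≢ y
x∈p-y⇒x≢y {S = _ ∷ _} {y = zero}  (there x∈) ()
x∈p-y⇒x≢y {S = _ ∷ _} {y = suc y} (there x∈) refl = x∈p-y⇒x≢y x∈ refl

∈─⇒∉ : ∀ {n} {S T : Subset n} {x} → x ∈ S ─ T → x ∉ T
∈─⇒∉ {S = _ ∷ _} {T = false ∷ _} here ()
∈─⇒∉ {S = _ ∷ _} {T = _     ∷ _} (there x∈) (there x∈T) = ∈─⇒∉ x∈ x∈T

-- Walks, paths and components of a graph.

module _ {n} (G : Graph n) where
  open Graph G renaming (sym to Adj-sym)

  _++ʷ_ : ∀ {u v w k ℓ} → Walk G u v k → Walk G v w ℓ → Walk G u w (k + ℓ)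
  []      ++ʷ q = q
  (e ∷ p) ++ʷ q = e ∷ (p ++ʷ q)

  reverse : ∀ {u v ℓ} → Walk G u v ℓ → Walk G v u ℓ
  reverse []                  = []
  reverse (_∷_ {ℓ = ℓ} e p) =
    subst (Walk G _ _) (+-comm ℓ 1) (reverse p ++ʷ (Adj-sym e ∷ []))

  -- The lengths of the pieces are kept because a shortest walk will be cut here: the distances from
  -- an end of the crossing edge to `u` and `w` then add up.
  Crossing : Pred (Fin n) 0ℓ → Fin n → Fin n → ℕ → Set
  Crossing P u w ℓ = ∃₂ λ x y → ∃₂ λ i j →
    Walk G u x i × Adj x y × Walk G y w j × i + suc j ≡ ℓ × P x × ¬ P y

  crossing : ∀ {P} → Decidable P → ∀ {u w ℓ} → Walk G u w ℓ → P u → ¬ P w → Crossing P u w ℓ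
  crossing P? [] Pu ¬Pw = contradiction Pu ¬Pw
  crossing P? (_∷_ {v = v} e p) Pu ¬Pw with P? v
  ... | no  ¬Pv = _ , v , 0 , _ , [] , e , p , refl , Pu , ¬Pv
  ... | yes Pv  with crossing P? p Pv ¬Pw
  ...   | x , y , i , j , q , e′ , q′ , eq , Px , ¬Py =
    x , y , suc i , j , e ∷ q , e′ , q′ , cong suc eq , Px , ¬Py

  WalkIn : Pred (Fin n) 0ℓ → Fin n → Fin n → Set
  WalkIn P u v = ∃₂ λ ℓ (p : Walk G u v ℓ) → All P (vertices G p)

  snoc : ∀ {P u v w ℓ} (p : Walk G u v ℓ) → All P (vertices G p) → Adj v w → P w → WalkIn P u w
  snoc []      (Pu ∷ []) e Pw = _ , e ∷ [] , Pu ∷ Pw ∷ []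
  snoc (e ∷ p) (Pu ∷ ps) e′ Pw with snoc p ps e′ Pw
  ... | _ , p′ , ps′ = _ , e ∷ p′ , Pu ∷ ps′

  Path : Pred (Fin n) 0ℓ → Fin n → Fin n → Set
  Path P u v = ∃₂ λ ℓ (p : Walk G u v ℓ) → Unique (vertices G p) × All P (vertices G p)

  suffix : ∀ {P u v ℓ x} (p : Walk G u v ℓ) → Unique (vertices G p) → All P (vertices G p) →
           x ∈ₗ vertices G p → Path P x v
  suffix []      uniq       ps       (here refl) = _ , [] , uniq , ps
  suffix (e ∷ p) uniq       ps       (here refl) = _ , e ∷ p , uniq , ps
  suffix (e ∷ p) (_ ∷ uniq) (_ ∷ ps) (there x∈)  = suffix p uniq ps x∈

  walk⇒path : ∀ {P u v ℓ} (p : Walk G u v ℓ) → All P (vertices G p) → Path P u v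
  walk⇒path []      ps = _ , [] , [] ∷ [] , ps
  walk⇒path {u = u} (e ∷ p) (Pu ∷ ps) with walk⇒path p ps
  ... | _ , q , uniq , qs with u ∈ₗ? vertices G q
    where open import Data.List.Membership.DecPropositional _≟_ using () renaming (_∈?_ to _∈ₗ?_)
  ...   | yes u∈q = suffix q uniq qs u∈q
  ...   | no  u∉q = _ , e ∷ q , ¬Any⇒All¬ _ u∉q ∷ uniq , Pu ∷ qs

  -- If `u ≢ q`, a path from `q` to `u` avoiding `p` would close to a cycle through `p`.
  neighbours-separated : ¬ Cycle G → ∀ {p q u ℓ} → Adj p q → Adj u p →
    (w : Walk G q u ℓ) → All (_≢ p) (vertices G w) → u ≡ q
  neighbours-separated acyclic e e′ w avoid with walk⇒path w avoid
  ... | _ , []       , _    , _      = refl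
  ... | _ , e″ ∷ w′ , uniq , avoid′ = ⊥-elim (acyclic
    (_ , _ , _ , s≤s (s≤s z≤n) , (e ∷ e″ ∷ w′ , All.map (λ x≢p p≡x → x≢p (sym p≡x)) avoid′ ∷ uniq) , e′))

  record Component (A : Subset n) (q : Fin n) : Set where
    field
      C         : Subset n
      q∈C       : q ∈ C
      C⊆A       : C ⊆ A
      closed    : ∀ {u w} → u ∈ C → w ∈ A → Adj u w → w ∈ C
      reachable : ∀ {u} → u ∈ C → WalkIn (_∈ A) q u

  component : ∀ {A q} → q ∈ A → Component A q
  component {A} {q} q∈A = grow ⁅ q ⁆ (⊃-wellFounded _) (x∈⁅x⁆ q)
    (λ u∈ → subst (_∈ A) (sym (x∈⁅y⁆⇒x≡y q u∈)) q∈A)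
    (λ u∈ → subst (WalkIn (_∈ A) q)
                  (sym (x∈⁅y⁆⇒x≡y q u∈)) (_ , [] , q∈A ∷ []))
    where
    grow : ∀ C → Acc _⊃_ C → q ∈ C → C ⊆ A →
           (∀ {u} → u ∈ C → WalkIn (_∈ A) q u) →
           Component A q
    grow C (acc rec) q∈C C⊆A reach
      with any? (λ u → any? (λ w → (u ∈? C) ×-dec (w ∈? A) ×-dec ¬? (w ∈? C) ×-dec adj? u w))
    ... | no closed = record
      { C = C ; q∈C = q∈C ; C⊆A = C⊆A ; reachable = reach
      ; closed = λ u∈C w∈A e → decidable-stable (_ ∈? C)
                                 λ w∉C → closed (_ , _ , u∈C , w∈A , w∉C , e) }
    ... | yes (u , w , u∈C , w∈A , w∉C , e) =
      grow (C ∪ ⁅ w ⁆) (rec (p⊆p∪q _ , w , q⊆p∪q C _ (x∈⁅x⁆ w) , w∉C)) (p⊆p∪q _ q∈C)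
        (λ x∈ → [ C⊆A , (λ x∈w → subst (_∈ A) (sym (x∈⁅y⁆⇒x≡y w x∈w)) w∈A) ]′ (x∈p∪q⁻ C _ x∈))
        (λ x∈ → [ reach , (λ x∈w → subst (WalkIn (_∈ A) q)
                                         (sym (x∈⁅y⁆⇒x≡y w x∈w)) w-reachable) ]′ (x∈p∪q⁻ C _ x∈))
      where
      w-reachable : WalkIn (_∈ A) q w
      w-reachable with reach u∈C
      ... | _ , p , ps = snoc p ps e w∈A

-- Splitting subtrees of a tree.

module _ {n} (T : Graph n) (isTree : IsTree T) where
  open Graph T renaming (sym to Adj-sym)

  private
    connected : Connected T
    connected = proj₁ (proj₂ isTree)

    acyclic : ¬ Cycle T
    acyclic = proj₂ (proj₂ isTree)

  -- The root may have several neighbours outside `S`, because branches below it are cut off one at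
  -- a time.
  record Rooted (S : Subset n) (p : Fin n) : Set where
    field
      root∈    : p ∈ S
      boundary : ∀ {s s′} → s ∈ S → s′ ∉ S → Adj s s′ → s ≡ p

  open Rooted

  data Split (S : Subset n) (p : Fin n) : Set where
    single : (∀ {s} → s ∈ S → s ≡ p) → Split S p
    branch : ∀ {C q} → C ⊂ S → S ─ C ⊂ S → Rooted C q → Rooted (S ─ C) p → Split S p

  -- Cut off the component `C` of a neighbour `q` of `p` in `S - p`. An edge leaving `C` can only
  -- lead to `p`, and acyclicity makes it start at `q`. An edge from the rest into `C` can only
  -- start at `p`.
  split : ∀ {S p} → Rooted S p → Split S p
  split {S} {p} R with any? (λ q → (q ∈? S) ×-dec adj? p q)
  ... | no lonely = single λ {s} s∈S → decidable-stable (s ≟ p) λ s≢p →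
    -- A walk from `s ≢ p` to `p` leaves `S - p`. It cannot leave `S` there, since only `p` has
    -- neighbours outside, so it enters `p` from a neighbour in `S`, and there is none.
    case crossing T (λ x → (x ∈? S) ×-dec ¬? (x ≟ p)) (proj₂ (connected s p))
                  (s∈S , s≢p) (λ (_ , p≢p) → p≢p refl) of
      λ (x , y , _ , _ , _ , e , _ , _ , (x∈S , x≢p) , y∉) → case ((y ∈? S) , (y ≟ p)) of λ where
        (no  y∉S , _)        → x≢p (boundary R x∈S y∉S e)
        (yes _   , yes refl) → lonely (x , x∈S , Adj-sym e)
        (yes y∈S , no  y≢p)  → y∉ (y∈S , y≢p)
  ... | yes (q , q∈S , e) = branch
    ((λ x∈C → C⊆S x∈C) , p , root∈ R , p∉C)
    (p─q⊆p S C , q , q∈S , λ q∈S─C → ∈─⇒∉ q∈S─C q∈C)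
    (record { root∈ = q∈C ; boundary = boundary-C })
    (record { root∈ = x∈p∧x∉q⇒x∈p─q (root∈ R) p∉C ; boundary = boundary-rest })
    where
    q≢p : q ≢ p
    q≢p refl = irrefl e
    open Component (component T {S - p} (x∈p∧x≢y⇒x∈p-y q∈S q≢p))
    C⊆S : C ⊆ S
    C⊆S x∈C = p─q⊆p S ⁅ p ⁆ (C⊆A x∈C)
    p∉C : p ∉ C
    p∉C p∈C = x∈p-y⇒x≢y {S = S} (C⊆A p∈C) refl
    boundary-C : ∀ {s s′} → s ∈ C → s′ ∉ C → Adj s s′ → s ≡ q
    boundary-C {s} {s′} s∈C s′∉C e′ with s′ ∈? S | s′ ≟ p
    ... | no  s′∉S | _        = ⊥-elim (p∉C (subst (_∈ C) (boundary R (C⊆S s∈C) s′∉S e′) s∈C))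
    ... | yes s′∈S | no s′≢p  = ⊥-elim (s′∉C (closed s∈C (x∈p∧x≢y⇒x∈p-y s′∈S s′≢p) e′))
    ... | yes _    | yes refl with reachable s∈C
    ...   | _ , w , w⊆ = neighbours-separated T acyclic e e′ w (All.map (x∈p-y⇒x≢y {S = S}) w⊆)
    boundary-rest : ∀ {s s′} → s ∈ S ─ C → s′ ∉ S ─ C → Adj s s′ → s ≡ p
    boundary-rest {s} {s′} s∈ s′∉ e′ with s′ ∈? C | s ≟ p
    ... | _        | yes s≡p = s≡p
    ... | no s′∉C  | no _    = boundary R (p─q⊆p S C s∈) (λ s′∈S → s′∉ (x∈p∧x∉q⇒x∈p─q s′∈S s′∉C)) e′
    ... | yes s′∈C | no s≢p  = ⊥-elim (∈─⇒∉ s∈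
      (closed s′∈C (x∈p∧x≢y⇒x∈p-y (p─q⊆p S C s∈) s≢p) (Adj-sym e′)))

-- Binary trees of separators.

-- A separator of fewer than k vertices is padded: superfluous vertices do no harm.
Separator : ℕ → ℕ → Set
Separator n k = Fin k → Fin n

Hits : ∀ {n k} → Separator n k → Fin n → Set
Hits Z u = ∃ λ i → Z i ≡ u

data Tree (n k : ℕ) : Set where
  empty : Separator n k → Tree n k
  leaf  : Fin n → Tree n k
  node  : Separator n k → Tree n k → Tree n k → Tree n k

data _∈ᵗ_ {n k} (u : Fin n) : Tree n k → Set where
  leaf  : u ∈ᵗ leaf u
  left  : ∀ {Z l r} → u ∈ᵗ l → u ∈ᵗ node Z l r
  right : ∀ {Z l r} → u ∈ᵗ r → u ∈ᵗ node Z l r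

_∉ᵗ_ : ∀ {n k} → Fin n → Tree n k → Set
u ∉ᵗ τ = ¬ u ∈ᵗ τ

_∈ᵗ?_ : ∀ {n k} u (τ : Tree n k) → Dec (u ∈ᵗ τ)
u ∈ᵗ? empty Z    = no λ ()
u ∈ᵗ? leaf x     = map′ (λ { refl → leaf }) (λ { leaf → refl }) (u ≟ x)
u ∈ᵗ? node Z l r = map′ [ left , right ]′ (λ { (left u∈l) → inj₁ u∈l ; (right u∈r) → inj₂ u∈r })
                        (u ∈ᵗ? l ⊎-dec u ∈ᵗ? r)

separator : ∀ {n k} → Tree n k → Separator n k
separator (empty Z)    = Z
separator (leaf x)     = λ _ → x
separator (node Z _ _) = Z

-- The separators only have to work inside B.
module Carvings {n} (G : Graph n) (B : Subset n) {k : ℕ} where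
  open Graph G using (Adj)

  -- Covering the crossing edges is enough: a walk inside `B` from `P` to its complement contains
  -- such an edge, hence a vertex of `Z`.
  Separates : Separator n k → Pred (Fin n) 0ℓ → Set
  Separates Z P = ∀ {u w} → u ∈ B → w ∈ B → Adj u w → P u → ¬ P w → Hits Z u ⊎ Hits Z w

  data Carving : Tree n k → Set where
    empty : ∀ {Z} → Carving (empty Z)
    leaf  : ∀ {x} → Carving (leaf x)
    node  : ∀ {Z l r} → Separates Z (_∈ᵗ node Z l r) → (∀ {u} → u ∈ᵗ l → u ∉ᵗ r) →
            Carving l → Carving r → Carving (node Z l r)

  _Carves_ : Tree n k → Pred (Fin n) 0ℓ → Set
  τ Carves P = Carving τ × (∀ {u} → u ∈ᵗ τ → P u) × (∀ {u} → P u → u ∈ᵗ τ)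

  separates-resp : ∀ {Z} {P Q : Pred (Fin n) 0ℓ} → (∀ {u} → P u → Q u) → (∀ {u} → Q u → P u) →
                   Separates Z P → Separates Z Q
  separates-resp P⇒Q Q⇒P sep u∈B w∈B e Qu ¬Qw = sep u∈B w∈B e (Q⇒P Qu) (¬Qw ∘ P⇒Q)

  -- Since `Z` contains every listed vertex of `B`, it separates each part of the list, so a chain
  -- of leaves can use it at every node.
  list-carving : ∀ Z {us} → Unique us → (∀ {u} → u ∈ₗ us → u ∈ B → Hits Z u) → ∃ (_Carves (_∈ₗ us))
  list-carving Z {[]}     _            hits = empty Z , empty , (λ ()) , (λ ())
  list-carving Z {x ∷ xs} (x∉xs ∷ uniq) hits with list-carving Z uniq (hits ∘ there)
  ... | τ , carving , ∈τ⇒ , ⇒∈τ =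
    node Z (leaf x) τ
    , node (λ u∈B _ _ u∈ _ → inj₁ (hits (sound u∈) u∈B))
           (λ { leaf x∈τ → All¬⇒¬Any x∉xs (∈τ⇒ x∈τ) }) leaf carving
    , sound
    , λ { (here refl) → left leaf ; (there u∈) → right (⇒∈τ u∈) }
    where
    sound : ∀ {u} → u ∈ᵗ node Z (leaf x) τ → u ∈ₗ x ∷ xs
    sound (left leaf)   = here refl
    sound (right u∈)    = there (∈τ⇒ u∈)

-- From a tree decomposition to a carving.

pad : ∀ {A : Set} {m k} → m ≤ k → A → (f : Fin m → A) → ∃ λ (g : Fin k → A) → ∀ i → ∃ λ j → g j ≡ f i
pad z≤n       a f = (λ _ → a) , λ ()
pad (s≤s m≤k) a f with pad m≤k a (f ∘ suc)
... | g , covers = (λ { zero → f zero ; (suc j) → g j })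
                 , λ { zero → zero , refl ; (suc i) → let (j , eq) = covers i in suc j , eq }

module _ {n} (G : Graph n) (B : Subset n) {t : ℕ} (v : Fin n)
         (D : TreeDecomposition (G [ B ])) (width : Width≤ D t) where
  open TreeDecomposition D
  open Carvings G B {suc t}
  open Rooted

  private
    bagCover : ∀ p → ∃ λ (Z : Separator n (suc t)) → ∀ i → ∃ λ j → Z j ≡ element B (element (bag p) i)
    bagCover p = pad (width p) v (element B ∘ element (bag p))

    bagSeparator : Fin size → Separator n (suc t)
    bagSeparator p = proj₁ (bagCover p)

    bag-hits : ∀ {p i} → i ∈ bag p → Hits (bagSeparator p) (element B i)
    bag-hits {p} i∈ with element-surjective i∈
    ... | j , refl = proj₂ (bagCover p) j

    ∈-nodesOf⁺ : ∀ {i q} → i ∈ bag q → q ∈ nodesOf i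
    ∈-nodesOf⁺ {i} {q} i∈ = lookup⇒[]= q _ (trans (lookup∘tabulate _ q) ([]=⇒lookup i∈))

    ∈-nodesOf⁻ : ∀ {i q} → q ∈ nodesOf i → i ∈ bag q
    ∈-nodesOf⁻ {i} {q} q∈ = lookup⇒[]= i _ (trans (sym (lookup∘tabulate _ q)) ([]=⇒lookup q∈))

    aNode : Fin size
    aNode = fromℕ< (proj₁ isTree)

    -- A vertex outside `B` gets an arbitrary node as its home. Thus all vertices of `G` become
    -- leaves, while separation constrains only those in `B`.
    homeCover : ∀ u → ∃ λ q → u ∈ B → ∃ λ i → element B i ≡ u × i ∈ bag q
    homeCover u with u ∈? B
    ... | no  u∉B = aNode , λ u∈B → contradiction u∈B u∉B
    ... | yes u∈B with element-surjective u∈B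
    ...   | i , eq with vertexCovered i
    ...     | q , i∈ = q , λ _ → i , eq , i∈

    home : Fin n → Fin size
    home u = proj₁ (homeCover u)

    -- The nodes of i form a subtree, which leaves S only through its root.
    root-∈-bags : ∀ {S p} → Rooted tree isTree S p → ∀ {i q q′} →
                  i ∈ bag q → i ∈ bag q′ → q ∈ S → q′ ∉ S → i ∈ bag p
    root-∈-bags {S} {p} R {i} i∈q i∈q′ q∈S q′∉S
      with element-surjective (∈-nodesOf⁺ i∈q) | element-surjective (∈-nodesOf⁺ i∈q′)
    ... | a , refl | b , refl
      with crossing (tree [ nodesOf i ]) (λ x → element (nodesOf i) x ∈? S)
                    (proj₂ (nodesConnected i a b)) q∈S q′∉S
    ... | x , y , _ , _ , _ , e , _ , _ , x∈S , y∉S =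
      subst (λ z → i ∈ bag z) (boundary R x∈S y∉S e) (∈-nodesOf⁻ (element-∈ (nodesOf i) x))

    -- Some bag `q` contains both ends of the edge. If `q` is in `S`, then `w` lies in bags inside
    -- and outside `S`; otherwise `u` does. That vertex is therefore in the bag of the root.
    separates : ∀ {S p} → Rooted tree isTree S p → Separates (bagSeparator p) (λ u → home u ∈ S)
    separates {S} R {u} {w} u∈B w∈B e u∈S w∉S
      with proj₂ (homeCover u) u∈B | proj₂ (homeCover w) w∈B
    ... | i , refl , i∈ | j , refl , j∈ with edgeCovered e
    ...   | q , i∈q , j∈q with q ∈? S
    ...     | yes q∈S = inj₂ (bag-hits (root-∈-bags R j∈q j∈ q∈S w∉S))
    ...     | no  q∉S = inj₁ (bag-hits (root-∈-bags R i∈ i∈q u∈S q∉S))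

    -- Induction along `split`: the bag of `p` separates the vertices with home in `S`, whichever
    -- branches were cut off before.
    subtree-carving : ∀ {S p} → Acc _⊂_ S → Rooted tree isTree S p → ∃ (_Carves (λ u → home u ∈ S))
    subtree-carving {S} {p} (acc rec) R with split tree isTree R
    ... | branch {C} C⊂S S─C⊂S R₁ R₂ with subtree-carving (rec C⊂S) R₁ | subtree-carving (rec S─C⊂S) R₂
    ...   | τ₁ , carving₁ , ∈τ₁⇒ , ⇒∈τ₁ | τ₂ , carving₂ , ∈τ₂⇒ , ⇒∈τ₂ =
      node (bagSeparator p) τ₁ τ₂
      , node (separates-resp complete sound (separates R))
             (λ u∈₁ u∈₂ → ∈─⇒∉ (∈τ₂⇒ u∈₂) (∈τ₁⇒ u∈₁)) carving₁ carving₂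
      , sound , complete
      where
      sound : ∀ {u} → u ∈ᵗ node (bagSeparator p) τ₁ τ₂ → home u ∈ S
      sound (left u∈)  = proj₁ C⊂S (∈τ₁⇒ u∈)
      sound (right u∈) = p─q⊆p S C (∈τ₂⇒ u∈)
      complete : ∀ {u} → home u ∈ S → u ∈ᵗ node (bagSeparator p) τ₁ τ₂
      complete {u} u∈S with home u ∈? C
      ... | yes u∈C = left (⇒∈τ₁ u∈C)
      ... | no  u∉C = right (⇒∈τ₂ (x∈p∧x∉q⇒x∈p─q u∈S u∉C))
    -- Only the node `p` is left, so the vertices of `B` with home in `S` all lie in its bag.
    subtree-carving {S} {p} _ R | single only
      with list-carving (bagSeparator p) (filter⁺ at? (allFin⁺ n)) hits
      where
      at? : ∀ u → Dec (home u ∈ S)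
      at? u = home u ∈? S
      hits : ∀ {u} → u ∈ₗ List.filter at? (List.allFin n) → u ∈ B → Hits (bagSeparator p) u
      hits {u} u∈ u∈B with proj₂ (homeCover u) u∈B | only (proj₂ (∈-filter⁻ at? {xs = List.allFin n} u∈))
      ... | i , refl , i∈ | home≡p = bag-hits (subst (λ q → i ∈ bag q) home≡p i∈)
    ... | τ , carving , ∈τ⇒ , ⇒∈τ =
      τ , carving , (λ u∈ → proj₂ (∈-filter⁻ (λ u → home u ∈? S) {xs = List.allFin n} (∈τ⇒ u∈)))
      , (λ {u} u∈S → ⇒∈τ (∈-filter⁺ (λ u → home u ∈? S) (∈-allFin u) u∈S))

  carving-exists : ∃ λ τ → Carving τ × (∀ u → u ∈ᵗ τ)
  carving-exists with subtree-carving (⊂-wellFounded ⊤) whole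
    where
    whole : Rooted tree isTree ⊤ aNode
    whole = record { root∈ = ∈⊤ ; boundary = λ _ s′∉⊤ _ → contradiction ∈⊤ s′∉⊤ }
  ... | τ , carving , _ , ⇒∈τ = τ , carving , λ u → ⇒∈τ ∈⊤

-- Subtrees determined by a few vertices.

module _ {n k : ℕ} where

  -- The largest subtree of τ containing x but not y, provided that x ≢ y and x ∈ᵗ τ.
  excluding : Tree n k → Fin n → Fin n → Tree n k
  excluding (node Z l r) x y with y ∈ᵗ? node Z l r | x ∈ᵗ? l
  ... | no  _ | _     = node Z l r
  ... | yes _ | yes _ = excluding l x y
  ... | yes _ | no  _ = excluding r x y
  excluding τ            x y = τ

  -- `nothing` encodes an upper end at the root, where no vertex has to be excluded.
  upper : Tree n k → Fin n → Maybe (Fin n) → Tree n k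
  upper τ x nothing  = τ
  upper τ x (just y) = excluding τ x y

  -- The smallest subtree of τ containing both x and y, provided that x ∈ᵗ τ and y ∈ᵗ τ.
  lower : Tree n k → Fin n → Fin n → Tree n k
  lower (node Z l r) x y with (x ∈ᵗ? l ×-dec y ∈ᵗ? l) | (x ∈ᵗ? r ×-dec y ∈ᵗ? r)
  ... | yes _ | _     = lower l x y
  ... | no  _ | yes _ = lower r x y
  ... | no  _ | no  _ = node Z l r
  lower τ            x y = τ

  excluding-∉ : ∀ τ {x y} → y ∉ᵗ τ → excluding τ x y ≡ τ
  excluding-∉ (empty Z)        y∉ = refl
  excluding-∉ (leaf z)         y∉ = refl
  excluding-∉ (node Z l r) {x} {y} y∉ with y ∈ᵗ? node Z l r | x ∈ᵗ? l
  ... | no  _  | _ = refl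
  ... | yes y∈ | _ = contradiction y∈ y∉

  excluding-⊆ : ∀ τ {x y u} → u ∈ᵗ excluding τ x y → u ∈ᵗ τ
  excluding-⊆ (empty Z) u∈ = u∈
  excluding-⊆ (leaf z)  u∈ = u∈
  excluding-⊆ (node Z l r) {x} {y} u∈ with y ∈ᵗ? node Z l r | x ∈ᵗ? l
  ... | no  _ | _     = u∈
  ... | yes _ | yes _ = left (excluding-⊆ l u∈)
  ... | yes _ | no  _ = right (excluding-⊆ r u∈)

  upper-⊆ : ∀ τ {x y u} → u ∈ᵗ upper τ x y → u ∈ᵗ τ
  upper-⊆ τ {y = nothing} u∈ = u∈
  upper-⊆ τ {y = just _}  u∈ = excluding-⊆ τ u∈

  excluding-left : ∀ {Z l r x y} → x ∈ᵗ l → y ∈ᵗ node Z l r → excluding (node Z l r) x y ≡ excluding l x y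
  excluding-left {Z} {l} {r} {x} {y} x∈l y∈ with y ∈ᵗ? node Z l r | x ∈ᵗ? l
  ... | yes _  | yes _   = refl
  ... | no  y∉ | _       = contradiction y∈ y∉
  ... | yes _  | no  x∉l = contradiction x∈l x∉l

  excluding-right : ∀ {Z l r x y} → x ∉ᵗ l → y ∈ᵗ node Z l r → excluding (node Z l r) x y ≡ excluding r x y
  excluding-right {Z} {l} {r} {x} {y} x∉l y∈ with y ∈ᵗ? node Z l r | x ∈ᵗ? l
  ... | yes _  | no  _   = refl
  ... | no  y∉ | _       = contradiction y∈ y∉
  ... | yes _  | yes x∈l = contradiction x∈l x∉l

  lower-left : ∀ {Z l r x y} → x ∈ᵗ l → y ∈ᵗ l → lower (node Z l r) x y ≡ lower l x y
  lower-left {Z} {l} {r} {x} {y} x∈ y∈ with (x ∈ᵗ? l ×-dec y ∈ᵗ? l) | (x ∈ᵗ? r ×-dec y ∈ᵗ? r)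
  ... | yes _ | _ = refl
  ... | no ¬∈ | _ = contradiction (x∈ , y∈) ¬∈

  lower-right : ∀ {Z l r x y} → x ∉ᵗ l → x ∈ᵗ r → y ∈ᵗ r → lower (node Z l r) x y ≡ lower r x y
  lower-right {Z} {l} {r} {x} {y} x∉l x∈ y∈ with (x ∈ᵗ? l ×-dec y ∈ᵗ? l) | (x ∈ᵗ? r ×-dec y ∈ᵗ? r)
  ... | yes (x∈l , _) | _     = contradiction x∈l x∉l
  ... | no  _         | yes _ = refl
  ... | no  _         | no ¬∈ = contradiction (x∈ , y∈) ¬∈

  lower-node : ∀ {Z l r x y} → x ∉ᵗ r → y ∉ᵗ l → lower (node Z l r) x y ≡ node Z l r
  lower-node {Z} {l} {r} {x} {y} x∉r y∉l with (x ∈ᵗ? l ×-dec y ∈ᵗ? l) | (x ∈ᵗ? r ×-dec y ∈ᵗ? r)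
  ... | yes (_ , y∈l) | _             = contradiction y∈l y∉l
  ... | no  _         | yes (x∈r , _) = contradiction x∈r x∉r
  ... | no  _         | no  _         = refl

  lower-⊆ : ∀ τ {x y u} → u ∈ᵗ lower τ x y → u ∈ᵗ τ
  lower-⊆ (empty Z) u∈ = u∈
  lower-⊆ (leaf z)  u∈ = u∈
  lower-⊆ (node Z l r) {x} {y} u∈ with (x ∈ᵗ? l ×-dec y ∈ᵗ? l) | (x ∈ᵗ? r ×-dec y ∈ᵗ? r)
  ... | yes _ | _     = left (lower-⊆ l u∈)
  ... | no  _ | yes _ = right (lower-⊆ r u∈)
  ... | no  _ | no  _ = u∈

  children : ∀ {Z} {l r : Tree n k} {u} → u ∈ᵗ node Z l r → u ∈ᵗ l ⊎ u ∈ᵗ r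
  children (left u∈l)  = inj₁ u∈l
  children (right u∈r) = inj₂ u∈r

  -- Treats left and right children alike, so that later arguments about a child are made once.
  record Child (τ σ : Tree n k) : Set where
    field
      ⊆-parent      : ∀ {u} → u ∈ᵗ σ → u ∈ᵗ τ
      excluding-eq  : ∀ {x y} → x ∈ᵗ σ → y ∈ᵗ τ → excluding τ x y ≡ excluding σ x y
      lower-eq      : ∀ {x y} → x ∈ᵗ σ → y ∈ᵗ σ → lower τ x y ≡ lower σ x y

  child-left : ∀ {Z l r} → Child (node Z l r) l
  child-left = record { ⊆-parent = left ; excluding-eq = excluding-left ; lower-eq = lower-left }

  -- Disjointness enters because `excluding` and `lower` look into the left child first.
  child-right : ∀ {Z l r} → (∀ {u} → u ∈ᵗ r → u ∉ᵗ l) → Child (node Z l r) r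
  child-right disj = record
    { ⊆-parent     = right
    ; excluding-eq = excluding-right ∘ disj
    ; lower-eq     = λ x∈r → lower-right (disj x∈r) x∈r }

  -- A leaf is separated from everything, even from its own vertex, by that vertex.
  data Free (c : Fin n) : Tree n k → Set where
    outside : ∀ {τ} → c ∉ᵗ τ → Free c τ
    at-leaf : ∀ {x} → Free c (leaf x)

  free? : ∀ c τ → Dec (Free c τ)
  free? c (leaf x)       = yes at-leaf
  free? c τ@(empty _)    = yes (outside λ ())
  free? c τ@(node _ _ _) = map′ outside (λ { (outside c∉) → c∉ }) (¬? (c ∈ᵗ? τ))

-- Locating a vertex relative to the set `X`.

module _ {n} (G : Graph n) (B : Subset n) {k : ℕ} where
  open Carvings G B {k}

  excluding-carving : ∀ {τ} x y → Carving τ → Carving (excluding τ x y)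
  excluding-carving x y empty = empty
  excluding-carving x y leaf  = leaf
  excluding-carving x y (node {Z} {l} {r} sep disj carving₁ carving₂)
    with y ∈ᵗ? node Z l r | x ∈ᵗ? l
  ... | no  _ | _     = node sep disj carving₁ carving₂
  ... | yes _ | yes _ = excluding-carving x y carving₁
  ... | yes _ | no  _ = excluding-carving x y carving₂

  upper-carving : ∀ {τ} x y → Carving τ → Carving (upper τ x y)
  upper-carving x nothing  carving = carving
  upper-carving x (just y) carving = excluding-carving x y carving

  lower-carving : ∀ {τ} x y → Carving τ → Carving (lower τ x y)
  lower-carving x y empty = empty
  lower-carving x y leaf  = leaf
  lower-carving x y (node {Z} {l} {r} sep disj carving₁ carving₂)
    with (x ∈ᵗ? l ×-dec y ∈ᵗ? l) | (x ∈ᵗ? r ×-dec y ∈ᵗ? r)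
  ... | yes _ | _     = lower-carving x y carving₁
  ... | no  _ | yes _ = lower-carving x y carving₂
  ... | no  _ | no  _ = node sep disj carving₁ carving₂

  module _ (X : Subset n) where

    Meets : Tree n k → Set
    Meets τ = ∃ λ x → x ∈ X × x ∈ᵗ τ

    meets? : ∀ τ → Dec (Meets τ)
    meets? τ = any? λ x → (x ∈? X) ×-dec (x ∈ᵗ? τ)

    Span : Tree n k → Set
    Span τ = ∃₂ λ x y → (x ∈ X × x ∈ᵗ τ) × (y ∈ X × y ∈ᵗ τ) ×
             (∀ {z} → z ∈ X → z ∈ᵗ τ → z ∈ᵗ lower τ x y)

    -- The vertices of X in the upper subtree, which contains c, all lie in the lower one,
    -- from which c is separated.
    record Located (τ : Tree n k) (c : Fin n) : Set where
      field
        x₁ x₃ : Fin n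
        x₂    : Maybe (Fin n)
        x₁∈   : x₁ ∈ X × x₁ ∈ᵗ τ
        x₂∈   : MaybeAll (λ x → x ∈ X × x ∈ᵗ τ) x₂
        x₃∈   : x₃ ∈ X × x₃ ∈ᵗ τ
        c∈    : c ∈ᵗ upper τ x₁ x₂
        free  : Free c (lower τ x₁ x₃)
        cut   : ∀ {z} → z ∈ X → z ∈ᵗ τ → z ∉ᵗ upper τ x₁ x₂ ⊎ z ∈ᵗ lower τ x₁ x₃

    open Child

    module _ {τ σ σ′ : Tree n k} (child : Child τ σ) (disj : ∀ {u} → u ∈ᵗ σ → u ∉ᵗ σ′)
             (cover : ∀ {u} → u ∈ᵗ τ → u ∈ᵗ σ ⊎ u ∈ᵗ σ′) where

      only-in-child : ¬ Meets σ′ → ∀ {z} → z ∈ X → z ∈ᵗ τ → z ∈ᵗ σ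
      only-in-child avoids z∈X z∈ =
        [ id , (λ z∈σ′ → contradiction (_ , z∈X , z∈σ′) avoids) ]′ (cover z∈)

      meets-child : ¬ Meets σ′ → Meets τ → Meets σ
      meets-child avoids (x , x∈X , x∈) = x , x∈X , only-in-child avoids x∈X x∈

      span-child : ¬ Meets σ′ → Span σ → Span τ
      span-child avoids (x , y , (x∈X , x∈) , (y∈X , y∈) , covers) =
        x , y , (x∈X , ⊆-parent child x∈) , (y∈X , ⊆-parent child y∈)
        , λ {z} z∈X z∈ → subst (z ∈ᵗ_) (sym (lower-eq child x∈ y∈))
                                 (covers z∈X (only-in-child avoids z∈X z∈))

      -- With an `x₂`, both ends stay as they are. Without one, the upper end is `σ`: a vertex of
      -- `X` in `σ′`, taken as `x₂`, keeps it there; if `σ′` misses `X`, it grows to `τ`, which adds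
      -- no vertex of `X`.
      located-child : ∀ {c} → Child τ σ′ → Located σ c → Located τ c
      located-child {c} child′ L = relocate (Located.x₂ L) refl (meets? σ′)
        where
        open Located L
        lift : ∀ {x} → x ∈ X × x ∈ᵗ σ → x ∈ X × x ∈ᵗ τ
        lift (x∈X , x∈) = x∈X , ⊆-parent child x∈

        same-lower : lower τ x₁ x₃ ≡ lower σ x₁ x₃
        same-lower = lower-eq child (proj₂ x₁∈) (proj₂ x₃∈)

        cut-child : ∀ {z} → z ∈ X → z ∈ᵗ τ → z ∉ᵗ upper σ x₁ x₂ ⊎ z ∈ᵗ lower σ x₁ x₃
        cut-child {z} z∈X z∈ with z ∈ᵗ? σ
        ... | yes z∈σ = cut z∈X z∈σ
        ... | no  z∉σ = inj₁ (z∉σ ∘ upper-⊆ σ {x₁} {x₂})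

        same-upper : ∀ y → MaybeAll (λ x → x ∈ X × x ∈ᵗ τ) y →
                     upper τ x₁ y ≡ upper σ x₁ x₂ → Located τ c
        same-upper y y∈ eq = record
          { x₁ = x₁ ; x₂ = y ; x₃ = x₃ ; x₁∈ = lift x₁∈ ; x₂∈ = y∈ ; x₃∈ = lift x₃∈
          ; c∈   = subst (c ∈ᵗ_) (sym eq) c∈
          ; free = subst (Free c) (sym same-lower) free
          ; cut  = λ {z} z∈X z∈ → subst (λ υ → z ∉ᵗ upper τ x₁ y ⊎ z ∈ᵗ υ) (sym same-lower)
                     (subst (λ υ → z ∉ᵗ υ ⊎ z ∈ᵗ lower σ x₁ x₃) (sym eq) (cut-child z∈X z∈)) }

        relocate : ∀ y → y ≡ x₂ → Dec (Meets σ′) → Located τ c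
        relocate (just y) refl _ with x₂∈
        ... | just (y∈X , y∈) = same-upper (just y) (just (y∈X , ⊆-parent child y∈))
                                  (excluding-eq child (proj₂ x₁∈) (⊆-parent child y∈))
        relocate nothing refl (yes (y , y∈X , y∈)) =
          same-upper (just y) (just (y∈X , ⊆-parent child′ y∈))
            (trans (excluding-eq child (proj₂ x₁∈) (⊆-parent child′ y∈))
                   (excluding-∉ σ (λ y∈σ → disj y∈σ y∈)))
        relocate nothing refl (no avoids) = record
          { x₁ = x₁ ; x₂ = nothing ; x₃ = x₃ ; x₁∈ = lift x₁∈ ; x₂∈ = nothing ; x₃∈ = lift x₃∈
          ; c∈   = ⊆-parent child c∈
          ; free = subst (Free c) (sym same-lower) free
          ; cut  = λ {z} z∈X z∈ → let z∈σ = only-in-child avoids z∈X z∈ in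
                   [ contradiction z∈σ , (λ z∈l → inj₂ (subst (z ∈ᵗ_) (sym same-lower) z∈l)) ]′
                     (cut z∈X z∈σ) }

    -- Descend while only one child meets `X`. At the first node where both do, one vertex of `X`
    -- from each child pins down this node.
    span : ∀ {τ} → Carving τ → Meets τ → Span τ
    span leaf (x , x∈X , leaf) = x , x , (x∈X , leaf) , (x∈X , leaf) , λ _ z∈ → z∈
    span (node {Z} {l} {r} _ disj carving₁ carving₂) meets with meets? l | meets? r
    ... | yes (y , y∈X , y∈l) | yes (z , z∈X , z∈r) =
      y , z , (y∈X , left y∈l) , (z∈X , right z∈r)
      , λ {w} _ w∈ → subst (w ∈ᵗ_) (sym (lower-node (disj y∈l) (λ z∈l → disj z∈l z∈r))) w∈
    ... | _ | no avoids =
      span-child child-left disj children avoids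
        (span carving₁ (meets-child child-left disj children avoids meets))
    ... | no avoids | yes _ =
      span-child (child-right disj′) disj′ (swap ∘ children) avoids
        (span carving₂ (meets-child (child-right disj′) disj′ (swap ∘ children) avoids meets))
      where
      disj′ : ∀ {u} → u ∈ᵗ r → u ∉ᵗ l
      disj′ u∈r u∈l = disj u∈l u∈r

    -- If the child `σ` containing `c` misses `X`, then `X` meets `τ` only inside `σ′`: the upper
    -- end is `τ`, and the lower end is the subtree of `σ′` spanned by `X`, which omits `c`.
    located-in : ∀ {τ σ σ′ c} → Child τ σ → Child τ σ′ → (∀ {u} → u ∈ᵗ σ → u ∉ᵗ σ′) →
                 (∀ {u} → u ∈ᵗ τ → u ∈ᵗ σ ⊎ u ∈ᵗ σ′) → Meets τ → c ∈ᵗ σ →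
                 (Meets σ → Located σ c) → (Meets σ′ → Span σ′) → Located τ c
    located-in {τ} {σ} {σ′} {c} child child′ disj cover meets c∈ locate-σ span-σ′ with meets? σ
    ... | yes meets-σ = located-child child disj cover child′ (locate-σ meets-σ)
    ... | no  avoids  = spanned (⊆-parent child c∈)
      where
      disj′ : ∀ {u} → u ∈ᵗ σ′ → u ∉ᵗ σ
      disj′ u∈σ′ u∈σ = disj u∈σ u∈σ′
      spanned : c ∈ᵗ τ → Located τ c
      spanned c∈τ with span-σ′ (meets-child child′ disj′ (swap ∘ cover) avoids meets)
      ... | S@(x , y , (_ , x∈) , (_ , y∈) , _)
        = let _ , _ , x∈τ , y∈τ , covers = span-child child′ disj′ (swap ∘ cover) avoids S in record
        { x₁ = x ; x₂ = nothing ; x₃ = y ; x₁∈ = x∈τ ; x₂∈ = nothing ; x₃∈ = y∈τ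
        ; c∈   = c∈τ
        ; free = outside (λ c∈l → disj c∈ (lower-⊆ σ′ (subst (c ∈ᵗ_) (lower-eq child′ x∈ y∈) c∈l)))
        ; cut  = λ z∈X z∈ → inj₂ (covers z∈X z∈) }

    locate : ∀ {τ c} → Carving τ → Meets τ → c ∈ᵗ τ → Located τ c
    -- Here `c` itself is in `X`; both ends are its leaf, and `at-leaf` counts `c` as separated.
    locate leaf (x , x∈X , leaf) c∈ = record
      { x₁ = x ; x₂ = nothing ; x₃ = x ; x₁∈ = x∈X , leaf ; x₂∈ = nothing ; x₃∈ = x∈X , leaf
      ; c∈ = c∈ ; free = at-leaf ; cut = λ _ z∈ → inj₂ z∈ }
    locate (node _ disj carving₁ carving₂) meets (left c∈) =
      located-in child-left (child-right (λ u∈r u∈l → disj u∈l u∈r)) disj children meets c∈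
        (λ m → locate carving₁ m c∈) (span carving₂)
    locate (node _ disj carving₁ carving₂) meets (right c∈) =
      located-in (child-right (λ u∈r u∈l → disj u∈l u∈r)) child-left (λ u∈r u∈l → disj u∈l u∈r)
        (swap ∘ children) meets c∈ (λ m → locate carving₂ m c∈) (span carving₁)

-- Least numbers and extremal elements.

capped-least : ∀ {P : Pred ℕ 0ℓ} → Decidable P → ∀ m →
               ∃ λ d → (d < m → P d) × (∀ {ℓ} → P ℓ → d ≤ ℓ)
capped-least P? zero = 0 , (λ ()) , λ _ → z≤n
capped-least P? (suc m) with P? 0
... | yes P0 = 0 , (λ _ → P0) , λ _ → z≤n
... | no ¬P0 with capped-least (P? ∘ suc) m
...   | d , holds , least =
  suc d , (λ { (s≤s d<m) → holds d<m })
  , λ { {zero} P0 → contradiction P0 ¬P0 ; {suc ℓ} Pℓ → s≤s (least Pℓ) }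

best : ∀ {A : Set} {P : Pred A 0ℓ} {_≼_ : Rel A 0ℓ} → Decidable P → Total _≼_ → Transitive _≼_ →
       (xs : List A) → ∃ λ m → MaybeAll P m × (∀ {x} → x ∈ₗ xs → P x → MaybeAny (x ≼_) m)
best P? total ≼-trans [] = nothing , nothing , λ ()
best P? total ≼-trans (x ∷ xs) with best P? total ≼-trans xs | P? x
... | m       , Pm       , bound | no ¬Px = m , Pm , λ
  { (here refl) Px → contradiction Px ¬Px ; (there y∈) Py → bound y∈ Py }
... | nothing , nothing , bound | yes Px = just x , just Px , λ
  { (here refl) _ → just ([ id , id ]′ (total x x))
  ; (there y∈) Py → case bound y∈ Py of λ () }
... | just y , just Py , bound | yes Px with total x y
...   | inj₁ x≼y = just y , just Py , λ { (here refl) _ → just x≼y ; (there z∈) Pz → bound z∈ Pz }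
...   | inj₂ y≼x = just x , just Px , λ
  { (here refl) _ → just ([ id , id ]′ (total x x))
  ; (there z∈) Pz → case bound z∈ Pz of λ { (just z≼y) → just (≼-trans z≼y y≼x) } }

-- Balls and truncated distances.

module _ {n} (G : Graph n) where

  ∈-ball⁺ : ∀ {u w ℓ m} → Walk G u w ℓ → ℓ ≤ m → w ∈ ball G u (ℤ.+ m)
  -- The cap `suc ℓ` exceeds the length of the given walk, so the value `d` found is attained and is
  -- the distance.
  ∈-ball⁺ {u} {w} {ℓ} {m} p ℓ≤m with capped-least (walk? G u w) (suc ℓ)
  ... | d , holds , least = ∈-tabulate⁺ (λ w → dist≤? G u w (ℤ.+ m))
    (d , (holds (s≤s (least p)) , λ k<d q → <⇒≱ k<d (least q)) , ℤ.+≤+ (≤-trans (least p) ℓ≤m))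

  ∈-ball⁻ : ∀ {u w m} → w ∈ ball G u (ℤ.+ m) → ∃ λ ℓ → Walk G u w ℓ × ℓ ≤ m
  ∈-ball⁻ {u} {w} {m} w∈ with ∈-tabulate⁻ (λ w → dist≤? G u w (ℤ.+ m)) w∈
  ... | ℓ , (p , _) , ℤ.+≤+ ℓ≤m = ℓ , p , ℓ≤m

  negative-ball-empty : ∀ {u w m} → w ∉ ball G u ℤ.-[1+ m ]
  negative-ball-empty {u} {m = m} w∈ with ∈-tabulate⁻ (λ w → dist≤? G u w ℤ.-[1+ m ]) w∈
  ... | _ , _ , ()

module Distance {n} (G : Graph n) (r : ℕ) where
  open Graph G using () renaming (sym to Adj-sym)

  abstract

    -- The distance, truncated to r + 1.
    δ : Fin n → Fin n → ℕ
    δ u w = proj₁ (capped-least (walk? G u w) (suc r))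

    δ-walk : ∀ {u w} → δ u w ≤ r → Walk G u w (δ u w)
    δ-walk {u} {w} δ≤r = proj₁ (proj₂ (capped-least (walk? G u w) (suc r))) (s≤s δ≤r)

    δ-least : ∀ {u w ℓ} → Walk G u w ℓ → δ u w ≤ ℓ
    δ-least {u} {w} = proj₂ (proj₂ (capped-least (walk? G u w) (suc r)))

  -- As `s ≤ r`, both summands are below the truncation value and are lengths of actual walks.
  δ-triangle : ∀ {u v w s} → s ≤ r → δ u v + δ v w ≤ s → δ u w ≤ s
  δ-triangle {u} {v} {w} s≤r sum≤s = ≤-trans (δ-least (_++ʷ_ G uv vw)) sum≤s
    where
    uv : Walk G u v (δ u v)
    uv = δ-walk (≤-trans (m≤m+n _ (δ v w)) (≤-trans sum≤s s≤r))
    vw : Walk G v w (δ v w)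
    vw = δ-walk (≤-trans (m≤n+m _ (δ u v)) (≤-trans sum≤s s≤r))

  ∈-ball⇒δ≤ : ∀ {c w s} → w ∈ ball G c (ℤ.+ s) → δ c w ≤ s
  ∈-ball⇒δ≤ w∈ with ∈-ball⁻ G w∈
  ... | _ , p , ℓ≤s = ≤-trans (δ-least p) ℓ≤s

  δ≤⇒∈-ball : ∀ {c w s} → s ≤ r → δ c w ≤ s → w ∈ ball G c (ℤ.+ s)
  δ≤⇒∈-ball s≤r δ≤s = ∈-ball⁺ G (δ-walk (≤-trans δ≤s s≤r)) δ≤s

  module _ (v : Fin n) {k : ℕ} where
    private
      B : Subset n
      B = ball G v (ℤ.+ (2 * r))
    open Carvings G B {k}

    Through : ∀ {m} → Separator n m → Fin n → Fin n → ℕ → Set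
    Through Z c y s = ∃ λ i → δ c (Z i) + δ (Z i) y ≤ s

    -- A shortest walk from c to y stays in B, since v and y are within r of c.
    through-separator : ∀ {Z P} → Decidable P → Separates Z P → ∀ {c y s} →
      δ c v ≤ r → s ≤ r → δ c y ≤ s → P c → ¬ P y → Through Z c y s
    through-separator {Z} P? sep {c} {y} {s} cv≤r s≤r cy≤s Pc ¬Py
      with crossing G P? (δ-walk (≤-trans cy≤s s≤r)) Pc ¬Py
    ... | x , x′ , i , j , p , e , q , i+1+j≡ , Px , ¬Px′ =
      -- Whichever end of the crossing edge is in `Z` lies on a shortest walk from `c` to `y`, so
      -- passing through it costs no more than `δ c y`.
      [ (λ { (a , refl) → a , via p (e ∷ q) i+1+j≡ })
      , (λ { (a , refl) → a , via pe q i+1+j≡′ }) ]′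
        (sep (∈B p (e ∷ q) i+1+j≡) (∈B pe q i+1+j≡′) e Px ¬Px′)
      where
      pe : Walk G c x′ (i + 1)
      pe = _++ʷ_ G p (e ∷ [])
      i+1+j≡′ : (i + 1) + j ≡ δ c y
      i+1+j≡′ = trans (+-assoc i 1 j) i+1+j≡
      via : ∀ {z a b} → Walk G c z a → Walk G z y b → a + b ≡ δ c y → δ c z + δ z y ≤ s
      via p q eq = ≤-trans (+-mono-≤ (δ-least p) (δ-least q)) (≤-trans (≤-reflexive eq) cy≤s)
      ∈B : ∀ {z a b} → Walk G c z a → Walk G z y b → a + b ≡ δ c y → z ∈ B
      ∈B {z} {a} {b} p q eq = ∈-ball⁺ G (_++ʷ_ G (reverse G (δ-walk cv≤r)) p)
        (≤-trans (+-mono-≤ cv≤r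
                   (≤-trans (m≤m+n a b) (≤-trans (≤-reflexive eq) (≤-trans cy≤s s≤r))))
                 (≤-reflexive (cong (r +_) (sym (+-identityʳ r)))))

  module _ (v : Fin n) {t : ℕ} where
    open Carvings G (ball G v (ℤ.+ (2 * r))) {suc t}

    carving-separates : ∀ {τ} → Carving τ → Separates (separator τ) (_∈ᵗ τ)
    carving-separates empty            _   _   _ ()
    carving-separates leaf             _   _   _ leaf _ = inj₁ (zero , refl)
    carving-separates (node sep _ _ _) u∈B w∈B e u∈ w∉ = sep u∈B w∈B e u∈ w∉

    separates-complement : ∀ {Z} {τ : Tree n (suc t)} → Separates Z (_∈ᵗ τ) → Separates Z (_∉ᵗ τ)
    separates-complement {τ = τ} sep {w = w} u∈B w∈B e u∉ w∈ =
      swap (sep w∈B u∈B (Adj-sym e) (decidable-stable (w ∈ᵗ? τ) w∈) u∉)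

    -- If `y` is outside `α`, a shortest walk from `c` leaves `α`; if `y` is in `β` and `c` is not,
    -- the walk enters `β`. Either way it meets a separator.
    through-region : ∀ {α β : Tree n (suc t)} → Carving α → Carving β → ∀ {c y s} →
      c ∈ᵗ α → Free c β → y ∉ᵗ α ⊎ y ∈ᵗ β → δ c v ≤ r → s ≤ r → δ c y ≤ s →
      Through v {suc t} (separator α ++ separator β) c y s
    through-region {α} {β} cα cβ {c} {y} {s} c∈α _ (inj₁ y∉α) cv≤r s≤r cy≤s
      with through-separator v (_∈ᵗ? α) (carving-separates cα) cv≤r s≤r cy≤s c∈α y∉α
    ... | i , ≤s = i ↑ˡ suc t , subst (λ z → δ c z + δ z y ≤ s)
                                   (sym (lookup-++ˡ (separator α) (separator β) i)) ≤s
    through-region {α} {β} cα cβ {c} {y} {s} _ (outside c∉β) (inj₂ y∈β) cv≤r s≤r cy≤s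
      with through-separator v (λ u → ¬? (u ∈ᵗ? β))
             (separates-complement {τ = β} (carving-separates cβ)) cv≤r s≤r cy≤s c∉β (λ y∉β → y∉β y∈β)
    ... | i , ≤s = suc t ↑ʳ i , subst (λ z → δ c z + δ z y ≤ s)
                                   (sym (lookup-++ʳ (separator α) (separator β) i)) ≤s
    -- Now `c` may be the leaf `x` itself, so no walk need enter `β`. But `y` is `x`, its own
    -- separator, and the detour ends there at no extra cost.
    through-region {α} {β = leaf x} cα cβ {c} {y} {s} _ at-leaf (inj₂ leaf) cv≤r s≤r cy≤s =
      suc t ↑ʳ zero , subst (λ z → δ c z + δ z y ≤ s)
                         (sym (lookup-++ʳ (separator α) (λ _ → x) zero))
                         (≤-trans (+-mono-≤ cy≤s (δ-least {x} [])) (≤-reflexive (+-identityʳ s)))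

-- The compression scheme.

module Scheme {n} (G : Graph n) (r t : ℕ) (c₀ : Fin n)
              (carve : ∀ v → ∃ λ τ → Carvings.Carving G (ball G v (ℤ.+ (2 * r))) {suc t} τ ×
                                     (∀ u → u ∈ᵗ τ)) where
  open Distance G r

  K : ℕ
  K = suc t + suc t

  H : Hypergraph n
  H = ballHypergraph G r

  tree-of : Fin n → Tree n (suc t)
  tree-of v = proj₁ (carve v)

  -- Depends on stored vertices only and not on the centre, so the decoder can rebuild it.
  module Region (v x₁ : Fin n) (x₂ : Maybe (Fin n)) (x₃ : Fin n) where

    upper-end lower-end : Tree n (suc t)
    upper-end = upper (tree-of v) x₁ x₂
    lower-end = lower (tree-of v) x₁ x₃

    Z : Separator n K
    Z = separator upper-end ++ separator lower-end

    detour : Fin n → Fin K → Fin n → ℕ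
    detour c i x = δ c (Z i) + δ (Z i) x

    -- The first condition keeps shortest walks from `c` to vertices within `s ≤ r` inside the ball
    -- where the separators work; the next two place `c` in the region.
    Accepts : (pos neg : Fin K → Maybe (Fin n)) → Fin n → ℕ → Set
    Accepts pos neg c s = δ c v ≤ s × c ∈ᵗ upper-end × Free c lower-end ×
      (∀ i → MaybeAll (λ x → detour c i x ≤ s) (pos i)) ×
      (∀ i → MaybeAll (λ y → ¬ detour c i y ≤ s) (neg i))

    accepts? : ∀ pos neg c s → Dec (Accepts pos neg c s)
    accepts? pos neg c s = δ c v ≤? s ×-dec c ∈ᵗ? upper-end ×-dec free? c lower-end ×-dec
      all? (λ i → MaybeAll.dec (λ x → detour c i x ≤? s) (pos i)) ×-dec
      all? (λ i → MaybeAll.dec (λ y → ¬? (detour c i y ≤? s)) (neg i))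

    through : ∀ {c y s} → c ∈ᵗ upper-end → Free c lower-end → y ∉ᵗ upper-end ⊎ y ∈ᵗ lower-end →
              δ c v ≤ s → s ≤ r → δ c y ≤ s → ∃ λ i → detour c i y ≤ s
    through c∈ free cut cv≤s s≤r = through-region v
      (upper-carving G _ x₁ x₂ (proj₁ (proj₂ (carve v))))
      (lower-carving G _ x₁ x₃ (proj₁ (proj₂ (carve v)))) c∈ free cut (≤-trans cv≤s s≤r) s≤r

  Candidate : Fin n → Fin n → Maybe (Fin n) → Fin n → (pos neg : Fin K → Maybe (Fin n)) → Set
  Candidate v x₁ x₂ x₃ pos neg = ∃ λ c → ∃ λ s → s < suc r × Region.Accepts v x₁ x₂ x₃ pos neg c s

  candidate? : ∀ v x₁ x₂ x₃ pos neg → Dec (Candidate v x₁ x₂ x₃ pos neg)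
  candidate? v x₁ x₂ x₃ pos neg =
    any? λ c → anyUpTo? (Region.accepts? v x₁ x₂ x₃ pos neg c) (suc r)

  -- The empty ball of radius -1: it serves samples with empty `X⁺`, and as a default value it keeps
  -- the scheme proper.
  no-ball : ∃ H
  no-ball = ball G c₀ ℤ.-[1+ 0 ] , c₀ , ℤ.-[1+ 0 ] , ℤ.-≤+ , refl

  candidate-ball : ∀ {v x₁ x₂ x₃ pos neg} → Dec (Candidate v x₁ x₂ x₃ pos neg) → ∃ H
  candidate-ball (yes (c , s , s≤s s≤r , _)) = ball G c (ℤ.+ s) , c , ℤ.+ s , ℤ.+≤+ s≤r , refl
  candidate-ball (no _)                      = no-ball

  decode : Array n (4 + (K + K)) → ∃ H
  decode (just v ∷ just x₁ ∷ x₂ ∷ just x₃ ∷ rest)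
    = candidate-ball {x₂ = x₂}
        (candidate? v x₁ x₂ x₃ (λ i → lookup rest (i ↑ˡ K)) (λ i → lookup rest (K ↑ʳ i)))
  decode _ = no-ball

  Fits : (X⁺ X⁻ : Subset n) → Fin n → ℕ → Set
  Fits X⁺ X⁻ c s = (∀ x → x ∈ X⁺ → δ c x ≤ s) × (∀ y → y ∈ X⁻ → ¬ δ c y ≤ s)

  fits? : ∀ X⁺ X⁻ c s → Dec (Fits X⁺ X⁻ c s)
  fits? X⁺ X⁻ c s = all? (λ x → (x ∈? X⁺) →-dec (δ c x ≤? s))
              ×-dec all? (λ y → (y ∈? X⁻) →-dec ¬? (δ c y ≤? s))

  fits⇒realizes : ∀ (x : Sample H) {c s} → s ≤ r → Fits (Sample.X⁺ x) (Sample.X⁻ x) c s →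
                  Realizes (ball G c (ℤ.+ s)) x
  fits⇒realizes x s≤r (fit⁺ , fit⁻) =
    (λ u∈ → δ≤⇒∈-ball s≤r (fit⁺ _ u∈))
    , λ (u , u∈) → let u∈ball , u∈X⁻ = x∈p∩q⁻ _ _ u∈ in fit⁻ u u∈X⁻ (∈-ball⇒δ≤ u∈ball)

  -- A vertex of `X⁺` rules out the empty balls of negative radius.
  fitting-ball : ∀ {X⁺ X⁻} → Nonempty X⁺ → (∃[ e ] H e × X⁺ ⊆ e × Empty (X⁻ ∩ e)) →
                 ∃ λ c → ∃ λ s → s < suc r × Fits X⁺ X⁻ c s
  fitting-ball (v , v∈) (_ , (c , ℤ.-[1+ m ] , _ , refl) , ⊆e , _) =
    contradiction (⊆e v∈) (negative-ball-empty G {c} {m = m})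
  fitting-ball _ (_ , (c , ℤ.+ s , ℤ.+≤+ s≤r , refl) , ⊆e , ∩e) =
    c , s , s≤s s≤r , (λ x x∈ → ∈-ball⇒δ≤ (⊆e x∈))
    , λ y y∈ δ≤s → ∩e (y , x∈p∩q⁺ (y∈ , δ≤⇒∈-ball s≤r δ≤s))

  Compression : Sample H → Set
  Compression x = ∃ λ (a : Array n (4 + (K + K))) →
    VecAll (MaybeAll (_∈ (Sample.X⁺ x ∪ Sample.X⁻ x))) a × Realizes (proj₁ (decode a)) x

  module _ (x : Sample H) where
    open Sample x

    private
      X : Subset n
      X = X⁺ ∪ X⁻

    module Encode {v} (v∈X⁺ : v ∈ X⁺) {c s} (s≤r : s ≤ r) (fits : Fits X⁺ X⁻ c s)
                  (L : Located G (ball G v (ℤ.+ (2 * r))) X (tree-of v) c) where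

      open Located L
      open Region v x₁ x₂ x₃

      cut-X : ∀ {z} → z ∈ X → z ∉ᵗ upper-end ⊎ z ∈ᵗ lower-end
      cut-X z∈ = cut z∈ (proj₂ (proj₂ (carve v)) _)

      farthest : ∀ i → ∃ λ m → MaybeAll (λ z → z ∈ X⁺ × detour c i z ≤ s) m ×
        (∀ {z} → z ∈ₗ List.allFin n → z ∈ X⁺ × detour c i z ≤ s →
         MaybeAny (λ w → δ (Z i) z ≤ δ (Z i) w) m)
      farthest i = best (λ z → (z ∈? X⁺) ×-dec (detour c i z ≤? s))
        (λ z w → ≤-total (δ (Z i) z) (δ (Z i) w)) ≤-trans (List.allFin n)

      -- All of `X⁻` competes here: by the triangle inequality, every detour from `c` to a vertex of
      -- `X⁻` exceeds `s`.
      nearest : ∀ i → ∃ λ m → MaybeAll (_∈ X⁻) m ×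
        (∀ {z} → z ∈ₗ List.allFin n → z ∈ X⁻ → MaybeAny (λ w → δ (Z i) w ≤ δ (Z i) z) m)
      nearest i = best (_∈? X⁻) (λ z w → ≤-total (δ (Z i) w) (δ (Z i) z))
        (λ z≽w w≽u → ≤-trans w≽u z≽w) (List.allFin n)

      pos neg : Fin K → Maybe (Fin n)
      pos i = proj₁ (farthest i)
      neg i = proj₁ (nearest i)

      rest : Array n (K + K)
      rest = tabulate pos Vec.++ tabulate neg

      rest-pos : ∀ i → lookup rest (i ↑ˡ K) ≡ pos i
      rest-pos i = trans (Vec.lookup-++ˡ (tabulate pos) (tabulate neg) i) (lookup∘tabulate pos i)

      rest-neg : ∀ i → lookup rest (K ↑ʳ i) ≡ neg i
      rest-neg i = trans (Vec.lookup-++ʳ (tabulate pos) (tabulate neg) i) (lookup∘tabulate neg i)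

      accepted : Accepts (λ i → lookup rest (i ↑ˡ K)) (λ i → lookup rest (K ↑ʳ i)) c s
      accepted = proj₁ fits v v∈X⁺ , c∈ , free
        , (λ i → subst (MaybeAll _) (sym (rest-pos i)) (MaybeAll.map proj₂ (proj₁ (proj₂ (farthest i)))))
        , (λ i → subst (MaybeAll _) (sym (rest-neg i))
                   (MaybeAll.map (λ y∈ ≤s → proj₂ fits _ y∈ (δ-triangle {v = Z i} s≤r ≤s))
                                 (proj₁ (proj₂ (nearest i)))))

      -- For `X⁺`, separation is applied to the original `c`: `z` is reached through some `Z i`, and
      -- `c′` reaches the farthest such vertex through `Z i`, hence also `z`. For `X⁻` it is applied
      -- to `c′`: reaching `z` through `Z i` would give a short detour to the stored nearest vertex,
      -- which `Accepts` forbids.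
      accepted-fits : ∀ {c′ s′} → s′ ≤ r →
        Accepts (λ i → lookup rest (i ↑ˡ K)) (λ i → lookup rest (K ↑ʳ i)) c′ s′ → Fits X⁺ X⁻ c′ s′
      accepted-fits {c′} {s′} s′≤r (c′v≤s′ , c′∈ , free′ , pos-ok , neg-ok) = fit⁺ , fit⁻
        where
        fit⁺ : ∀ z → z ∈ X⁺ → δ c′ z ≤ s′
        fit⁺ z z∈ with through c∈ free (cut-X (p⊆p∪q _ z∈)) (proj₁ fits v v∈X⁺) s≤r (proj₁ fits z z∈)
        ... | i , ≤s with pos i | proj₂ (proj₂ (farthest i)) (∈-allFin z) (z∈ , ≤s)
                        | subst (MaybeAll _) (rest-pos i) (pos-ok i)
        ...   | just w | just z≤w | just ≤s′ =
          δ-triangle {v = Z i} s′≤r (≤-trans (+-monoʳ-≤ (δ c′ (Z i)) z≤w) ≤s′)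

        fit⁻ : ∀ z → z ∈ X⁻ → ¬ δ c′ z ≤ s′
        fit⁻ z z∈ c′z≤s′ with through c′∈ free′ (cut-X (q⊆p∪q X⁺ _ z∈)) c′v≤s′ s′≤r c′z≤s′
        ... | i , ≤s′ with neg i | proj₂ (proj₂ (nearest i)) (∈-allFin z) z∈
                         | subst (MaybeAll _) (rest-neg i) (neg-ok i)
        ...   | just w | just w≤z | just ≰s′ =
          ≰s′ (≤-trans (+-monoʳ-≤ (δ c′ (Z i)) w≤z) ≤s′)

      array : Array n (4 + (K + K))
      array = just v ∷ just x₁ ∷ x₂ ∷ just x₃ ∷ rest

      sound : VecAll (MaybeAll (_∈ X)) array
      sound = just (p⊆p∪q _ v∈X⁺) ∷ just (proj₁ x₁∈) ∷ MaybeAll.map proj₁ x₂∈ ∷ just (proj₁ x₃∈) ∷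
        VecAll.++⁺
          (VecAll.tabulate⁺ λ i → MaybeAll.map (p⊆p∪q _ ∘ proj₁) (proj₁ (proj₂ (farthest i))))
          (VecAll.tabulate⁺ λ i → MaybeAll.map (q⊆p∪q X⁺ _) (proj₁ (proj₂ (nearest i))))

      realized : Realizes (proj₁ (decode array)) x
      realized = candidate-realizes
        (candidate? v x₁ x₂ x₃ (λ i → lookup rest (i ↑ˡ K)) (λ i → lookup rest (K ↑ʳ i)))
        where
        candidate-realizes : (d : Dec (Candidate v x₁ x₂ x₃ (λ i → lookup rest (i ↑ˡ K))
                                                            (λ i → lookup rest (K ↑ʳ i)))) →
                             Realizes (proj₁ (candidate-ball {x₂ = x₂} d)) x
        candidate-realizes (yes (c′ , s′ , s≤s s′≤r , accepts)) =
          fits⇒realizes x s′≤r (accepted-fits s′≤r accepts)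
        -- The search cannot fail, since the original pair `c`, `s` is a candidate.
        candidate-realizes (no none) = contradiction (c , s , s≤s s≤r , accepted) none

  compress : ∀ x → Compression x
  compress x@(record { X⁺ = X⁺ ; X⁻ = X⁻ ; consistent = consistent }) with nonempty? X⁺
  -- This array decodes to the empty ball, which realizes every sample with empty `X⁺`.
  ... | no empty⁺ = replicate _ nothing
    , VecAll.lookup⁻ (λ i → subst (MaybeAll (_∈ (X⁺ ∪ X⁻))) (sym (lookup-replicate i nothing)) nothing)
    , (λ u∈ → contradiction (_ , u∈) empty⁺)
    , λ (u , u∈) → negative-ball-empty G {c₀} {m = 0} (proj₁ (x∈p∩q⁻ _ _ u∈))
  ... | yes nonempty@(v , v∈X⁺)
    -- Consistency is irrelevant and yields no centre directly; as the existence of a fitting ball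
    -- is decidable, a finite search recovers one from `X⁺` and `X⁻` alone.
    with recompute (any? λ c → anyUpTo? (fits? X⁺ X⁻ c) (suc r)) (fitting-ball nonempty consistent)
  ...   | c , s , s≤s s≤r , fits = array , sound , realized
    where
    open Encode x v∈X⁺ s≤r fits
      (locate G (ball G v (ℤ.+ (2 * r))) (X⁺ ∪ X⁻) (proj₁ (proj₂ (carve v)))
              (v , p⊆p∪q _ v∈X⁺ , proj₂ (proj₂ (carve v)) v) (proj₂ (proj₂ (carve v)) c))

  scheme : ∃ λ (C : ArrayScheme H (4 + (K + K))) → Proper C
  scheme = record
    { κ        = proj₁ ∘ compress
    ; ρ        = proj₁ ∘ decode
    ; κ-sound  = proj₁ ∘ proj₂ ∘ compress
    ; realizes = proj₂ ∘ proj₂ ∘ compress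
    } , proj₂ ∘ decode

theorem8p1 : (f : ℕ → ℕ) (n : ℕ) → 0 < n →
    (G : Graph n) → LocalTreewidth≤ G f →
    (r : ℕ) → 0 < r →
    ∃ λ (C : ArrayScheme (ballHypergraph G r) (4 * f (2 * r) + 8)) → Proper C
theorem8p1 f n 0<n G localTreewidth r 0<r =
  subst (λ m → ∃ λ (C : ArrayScheme (ballHypergraph G r) m) → Proper C) (size (f (2 * r))) scheme
  where
  size : ∀ t → 4 + ((suc t + suc t) + (suc t + suc t)) ≡ 4 * t + 8
  size = solve 1 (λ t → let k = con 1 :+ t in
    con 4 :+ ((k :+ k) :+ (k :+ k)) := con 4 :* t :+ con 8) refl
  carve : ∀ v → ∃ λ τ → Carvings.Carving G (ball G v (ℤ.+ (2 * r))) {suc (f (2 * r))} τ × (∀ u → u ∈ᵗ τ)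
  carve v with localTreewidth (2 * r) (≤-trans 0<r (m≤m+n r _)) v
  ... | D , width = carving-exists G _ v D width
  open Scheme G r (f (2 * r)) (fromℕ< 0<n) carve
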